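{- Let $B$ be a collection of patterns. If $B$ is inversion monotone, then so are the four collections $$B^{\ell} = \{p : p \smallsetminus p_1 \in B\},\quad B^r = \{p : p \smallsetminus p_{|p|} \in B\},\quad B^u = \{p : p \smallsetminus |p| \in B\},\quad B^d = \{p : p \smallsetminus 1 \in B\}.$$
   Context: A pattern is a nonempty permutation; $|p|$ is the length of $p$. A permutation $\pi$ contains a pattern $p$ if $\pi$ (in one-line notation) has a subsequence order-isomorphic to $p$; otherwise it avoids $p$. For a permutation $p$ and a value $e\in\{1,\dots,|p|\}$, $p\smallsetminus e$ denotes the permutation order-isomorphic to the sequence obtained by removing the entry with value $e$ from the one-line notation of $p$. Thus $B^\ell, B^r, B^u, B^d$ consist of all patterns obtained from patterns in $B$ by inserting, in all possible ways, a new first entry, a new last entry, a new largest entry, or a new smallest entry, respectively. An inversion of $\pi$ is a pair $i<j$ with $\pi_i>\pi_j$. $\mathrm{av}_n^k(B)$ is the number of permutations in $S_n$ with exactly $k$ inversions that avoid every pattern in $B$. $B$ is inversion monotone if $\mathrm{av}_n^k(B)\le \mathrm{av}_{n+1}^k(B)$ for all integers $n,k\ge 0$ (where $S_0$ consists of the empty permutation). -}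

module Defs where

open import Data.Empty.Polymorphic using (⊥)
open import Data.Fin using (Fin; zero; suc; fromℕ; punchIn) renaming (_<_ to _<ᶠ_)
open import Data.Fin.Permutation
  using (Permutation′; _⟨$⟩ʳ_; _⟨$⟩ˡ_; _≈_; id; inverseˡ; inverseʳ; remove; insert;
         punchIn-permute; insert-punchIn; insert-remove)
open import Data.Fin.Properties using (punchIn-injective) renaming (_<?_ to _<ᶠ?_)
open import Data.List
  using (List; [_]; length; filter; allFin; cartesianProduct; cartesianProductWith)
open import Data.List.Membership.Propositional.Properties using (∈-allFin)
open import Data.List.Relation.Unary.All as All using ()
open import Data.List.Relation.Unary.AllPairs as AllPairs using ()
open import Data.List.Relation.Unary.Any as Any using (Any; here)
import Data.List.Relation.Unary.Any.Properties as Any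
open import Data.List.Relation.Unary.Unique.Propositional.Properties using (allFin⁺)
open import Data.List.Relation.Unary.Unique.Setoid using (Unique)
import Data.List.Relation.Unary.Unique.Setoid.Properties as Unique
open import Data.Nat using (ℕ; zero; suc; _≤_; _<_; z<s; _≟_)
open import Data.Product using (_×_; _,_; ∃-syntax)
open import Function using (_⇔_)
open import Level using (Level; 0ℓ) renaming (suc to lsuc)
open import Relation.Binary.Bundles using (Setoid)
open import Relation.Binary.Core using (_Preserves_⟶_)
open import Relation.Binary.PropositionalEquality
  using (_≡_; refl; sym; trans; cong; setoid; module ≡-Reasoning)
open import Relation.Nullary using (¬_)
open import Relation.Nullary.Decidable using (_×-dec_)
open import Relation.Unary using (Decidable)

private
  variable
    ℓ   : Level
    m n : ℕ

-- S_n is Permutation′ n up to _≈_ (pointwise equality).  Positions and values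
-- are numbered from 0: the one-line notation of π is
-- (π ⟨$⟩ʳ 0) (π ⟨$⟩ʳ 1) … (π ⟨$⟩ʳ (n ∸ 1)).

permutationSetoid : ℕ → Setoid 0ℓ 0ℓ
permutationSetoid n = record
  { Carrier       = Permutation′ n
  ; _≈_           = _≈_
  ; isEquivalence = record
    { refl  = λ _ → refl
    ; sym   = λ π≈ρ i → sym (π≈ρ i)
    ; trans = λ π≈ρ ρ≈σ i → trans (π≈ρ i) (ρ≈σ i)
    }
  }

-- Choose the first entry, then the pattern of the remaining entries.  By
-- allPermutations-complete and -unique, each permutation is listed exactly once
-- up to _≈_.
allPermutations : ∀ n → List (Permutation′ n)
allPermutations zero    = [ id ]
allPermutations (suc n) =
  cartesianProductWith (insert zero) (allFin (suc n)) (allPermutations n)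

-- The number of pairs of positions i < j with π_j < π_i.
inversions : Permutation′ n → ℕ
inversions {n} π =
  length (filter (λ (i , j) → (i <ᶠ? j) ×-dec ((π ⟨$⟩ʳ j) <ᶠ? (π ⟨$⟩ʳ i)))
                 (cartesianProduct (allFin n) (allFin n)))

infix 4 _≼_

-- p ≼ π: f lists the positions of a subsequence of π order-isomorphic to p.
_≼_ : Permutation′ m → Permutation′ n → Set
_≼_ {m} {n} p π = ∃[ f ]
  (f Preserves _<ᶠ_ {m} ⟶ _<ᶠ_ {n}) ×
  (∀ i j → (p ⟨$⟩ʳ i) <ᶠ (p ⟨$⟩ʳ j) ⇔ (π ⟨$⟩ʳ f i) <ᶠ (π ⟨$⟩ʳ f j))

infixl 7 _∖_

-- Delete the entry with value e (not the one at position e); `remove` also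
-- renumbers the remaining values order-preservingly.
_∖_ : Permutation′ (suc n) → Fin (suc n) → Permutation′ n
p ∖ e = remove (p ⟨$⟩ˡ e) p

-- An arbitrary, possibly infinite, set of nonempty permutations.
record Collection ℓ : Set (lsuc ℓ) where
  field
    member   : ∀ {n} → Permutation′ n → Set ℓ
    resp     : ∀ {n} {p q : Permutation′ n} → p ≈ q → member p → member q
    nonempty : ∀ {n} {p : Permutation′ n} → member p → 0 < n

open Collection public using (member)

infix 4 _∈_

_∈_ : Permutation′ n → Collection ℓ → Set ℓ
p ∈ B = member B p

Avoids : Collection ℓ → ∀ {n} → Permutation′ n → Set ℓ
Avoids B π = ∀ {m} (p : Permutation′ m) → p ∈ B → ¬ p ≼ π

-- As B is arbitrary, avoidance need not be decidable constructively, so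
-- counting takes a decision procedure; the result does not depend on which.
av : (B : Collection ℓ) (n k : ℕ) → Decidable (Avoids B {n}) → ℕ
av B n k avoids? =
  length (filter (λ π → (inversions π ≟ k) ×-dec avoids? π) (allPermutations n))

-- Classically the decision procedures always exist, so quantifying over them
-- is no restriction on B.
InversionMonotone : Collection ℓ → Set ℓ
InversionMonotone B =
  ∀ n k (avoids?₀ : Decidable (Avoids B {n})) (avoids?₁ : Decidable (Avoids B {suc n})) →
  av B n k avoids?₀ ≤ av B (suc n) k avoids?₁

remove-cong : ∀ {i j} {p q : Permutation′ (suc n)} → i ≡ j → p ≈ q → remove i p ≈ remove j q
remove-cong {i = i} {p = p} {q} refl p≈q k = punchIn-injective (p ⟨$⟩ʳ i) _ _ (begin
  punchIn (p ⟨$⟩ʳ i) (remove i p ⟨$⟩ʳ k)  ≡⟨ punchIn-permute p i k ⟨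
  p ⟨$⟩ʳ punchIn i k                      ≡⟨ p≈q (punchIn i k) ⟩
  q ⟨$⟩ʳ punchIn i k                      ≡⟨ punchIn-permute q i k ⟩
  punchIn (q ⟨$⟩ʳ i) (remove i q ⟨$⟩ʳ k)  ≡⟨ cong (λ v → punchIn v (remove i q ⟨$⟩ʳ k)) (p≈q i) ⟨
  punchIn (p ⟨$⟩ʳ i) (remove i q ⟨$⟩ʳ k)  ∎)
  where open ≡-Reasoning

∖-cong : ∀ {d e} {p q : Permutation′ (suc n)} → d ≡ e → p ≈ q → p ∖ d ≈ q ∖ e
∖-cong {d = d} {p = p} {q} refl p≈q = remove-cong {p = p} {q} (begin
  p ⟨$⟩ˡ d                      ≡⟨ inverseˡ q ⟨
  q ⟨$⟩ˡ (q ⟨$⟩ʳ (p ⟨$⟩ˡ d))    ≡⟨ cong (q ⟨$⟩ˡ_) (p≈q (p ⟨$⟩ˡ d)) ⟨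
  q ⟨$⟩ˡ (p ⟨$⟩ʳ (p ⟨$⟩ˡ d))    ≡⟨ cong (q ⟨$⟩ˡ_) (inverseʳ p) ⟩
  q ⟨$⟩ˡ d                      ∎) p≈q
  where open ≡-Reasoning

-- The patterns p with p ∖ e p ∈ B.
module _ (e : ∀ {n} → Permutation′ (suc n) → Fin (suc n))
         (e-cong : ∀ {n} {p q : Permutation′ (suc n)} → p ≈ q → e p ≡ e q)
         (B : Collection ℓ) where

  private
    mem : Permutation′ n → Set ℓ
    mem {zero}  _ = ⊥
    mem {suc n} p = p ∖ e p ∈ B

    mem-resp : {p q : Permutation′ n} → p ≈ q → mem p → mem q
    mem-resp {suc n} {p} {q} p≈q =
      Collection.resp B (∖-cong {p = p} {q} (e-cong {p = p} {q} p≈q) p≈q)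

    mem-nonempty : {p : Permutation′ n} → mem p → 0 < n
    mem-nonempty {suc n} _ = z<s

  extend : Collection ℓ
  extend = record
    { member   = mem
    ; resp     = λ {_} {p} {q} → mem-resp {p = p} {q}
    ; nonempty = λ {_} {p} → mem-nonempty {p = p}
    }

infix 8 _ˡ _ʳ _ᵘ _ᵈ

_ˡ _ʳ _ᵘ _ᵈ : Collection ℓ → Collection ℓ
_ˡ = extend (λ p → p ⟨$⟩ʳ zero) (λ p≈q → p≈q zero)
_ʳ = extend (λ {n} p → p ⟨$⟩ʳ fromℕ n) (λ {n} p≈q → p≈q (fromℕ n))
_ᵘ = extend (λ {n} _ → fromℕ n) (λ _ → refl)
_ᵈ = extend (λ _ → zero) (λ _ → refl)

insert-cong : ∀ {u v} {π ρ : Permutation′ n} → u ≡ v → π ≈ ρ →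
              insert zero u π ≈ insert zero v ρ
insert-cong refl π≈ρ zero    = refl
insert-cong {u = u} refl π≈ρ (suc i) = cong (punchIn u) (π≈ρ i)

insert-injective : ∀ {u v} {π ρ : Permutation′ n} →
                   insert zero u π ≈ insert zero v ρ → u ≡ v × π ≈ ρ
insert-injective {u = u} eq with refl ← eq zero =
  refl , λ i → punchIn-injective u _ _ (eq (suc i))

allPermutations-complete : (π : Permutation′ n) → Any (π ≈_) (allPermutations n)
allPermutations-complete {zero}  π = here λ ()
allPermutations-complete {suc n} π =
  Any.cartesianProductWith⁺ (insert zero)
    (λ {u} {ρ} π₀≡u π′≈ρ i →
      trans (sym (insert-remove zero π i))
            (insert-cong {π = remove zero π} {ρ} π₀≡u π′≈ρ i))
    (∈-allFin (π ⟨$⟩ʳ zero))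
    (allPermutations-complete (remove zero π))

allPermutations-unique : ∀ n → Unique (permutationSetoid n) (allPermutations n)
allPermutations-unique zero    = All.[] AllPairs.∷ AllPairs.[]
allPermutations-unique (suc n) =
  Unique.cartesianProductWith⁺
    (setoid (Fin (suc n))) (permutationSetoid n) (permutationSetoid (suc n))
    (insert zero)
    (λ {u} {v} {π} {ρ} → insert-injective {u = u} {v} {π} {ρ})
    (allFin⁺ (suc n)) (allPermutations-unique n)

{-# OPTIONS --safe #-}
module Submission where

-- A permutation π avoids Bˡ iff deleting its first entry leaves a permutation avoiding B, and the
-- deletion of a first entry v (counted from 0) removes exactly v inversions.  Hence
--   av (n+1) k Bˡ = ∑_{v ≤ n} av n (k − v) B,
-- and passing from n to n + 1 increases every summand and adds one more.  For Bʳ, Bᵘ and Bᵈ the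
-- deleted entry is the last, the largest or the smallest one, and v is replaced by the number of
-- inversions in which it takes part, which again runs through 0, …, n.

open import Data.Bool using (if_then_else_)
open import Data.Fin using (Fin; zero; suc; toℕ; fromℕ; inject₁; opposite; punchIn; punchOut)
  renaming (_<_ to _<ᶠ_)
open import Data.Fin.Permutation
  using (Permutation′; _⟨$⟩ʳ_; _⟨$⟩ˡ_; _≈_; inverseˡ; inverseʳ; remove; insert;
         punchIn-permute; insert-punchIn; insert-remove; remove-insert)
open import Data.Fin.Properties as Fin
  using (punchIn-cancel-≤; punchIn-mono-≤; punchInᵢ≢i; punchIn-punchOut; ≤fromℕ; toℕ-fromℕ;
         toℕ-inject₁; opposite-involutive; toℕ-injective; injective⇒≤)
  renaming (_<?_ to _<ᶠ?_; _≟_ to _≟ᶠ_)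
open import Data.List
  using (List; []; _∷_; _++_; map; length; filter; allFin; tabulate; cartesianProductWith; lookup)
open import Data.List.Membership.Propositional.Properties using (∈-allFin; ∈-lookup)
import Data.List.Membership.Setoid as Membership
import Data.List.Membership.Setoid.Properties as Membershipₚ
open import Data.List.Properties using (filter-++; filter-≐; filter-none; length-++)
import Data.List.Relation.Unary.All as All
import Data.List.Relation.Unary.AllPairs as AllPairs
open import Data.List.Relation.Unary.Any using (Any; index)
import Data.List.Relation.Unary.Any.Properties as Any
open import Data.List.Relation.Unary.Unique.Propositional.Properties using (allFin⁺)
open import Data.List.Relation.Unary.Unique.Setoid using (Unique)
import Data.List.Relation.Unary.Unique.Setoid.Properties as Unique
open import Data.Nat using (ℕ; zero; suc; _+_; _∸_; _≤_; _<_; z≤n; z<s; s<s; s<s⁻¹; _≟_; _≤?_)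
open import Data.Nat.Properties
  using (+-0-commutativeMonoid; +-identityʳ; +-assoc; +-mono-≤; +-cancelˡ-≡; +-cancelʳ-≡;
         m≤m+n; m+[n∸m]≡n; ≤-antisym; ≰⇒>; <⇒≱; <⇒≢; ≤⇒≯; ≮⇒≥; <-irrefl; <-trans; n≮0;
         module ≤-Reasoning)
open import Algebra.Properties.CommutativeMonoid.Sum +-0-commutativeMonoid
  using (sum; sum-syntax; sum-cong-≗; sum-replicate-zero; sum-init-last; sum-remove; sum-permute;
         ∑-distrib-+)
open import Data.Product using (_×_; _,_; proj₁; proj₂; Σ; ∃-syntax)
open import Function using (_∘_; _⇔_; mk⇔; Equivalence)
open import Level using (Level)
open import Relation.Binary.Bundles using (Setoid)
open import Relation.Binary.Core using (_Preserves_⟶_)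
open import Relation.Binary.Definitions using (tri<; tri≈; tri>)
open import Relation.Binary.PropositionalEquality
  using (_≡_; _≢_; refl; sym; trans; cong; cong₂; subst; subst₂; setoid; module ≡-Reasoning)
open import Relation.Nullary using (¬_; Dec; yes; no; does; contradiction)
open import Relation.Nullary.Decidable using (_×-dec_; map′; dec-false; does-⇔)
open import Relation.Unary using (Pred; Decidable)
open import Defs

private
  variable
    a b c ℓ ℓ₁ ℓ₂ : Level
    m n : ℕ

-- Indicators, sums and lengths of filtered lists

indicator : {P : Set ℓ} → Dec P → ℕ
indicator P? = if does P? then 1 else 0

indicator-⇔ : {P : Set ℓ₁} {Q : Set ℓ₂} → P ⇔ Q → (P? : Dec P) (Q? : Dec Q) →
              indicator P? ≡ indicator Q?
indicator-⇔ P⇔Q P? Q? = cong (if_then 1 else 0) (does-⇔ P⇔Q P? Q?)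

indicator-false : {P : Set ℓ} (P? : Dec P) → ¬ P → indicator P? ≡ 0
indicator-false P? ¬p = cong (if_then 1 else 0) (dec-false P? ¬p)

length-filter-∷ : {A : Set a} {P : Pred A ℓ} (P? : Decidable P) (x : A) (xs : List A) →
                  length (filter P? (x ∷ xs)) ≡ indicator (P? x) + length (filter P? xs)
length-filter-∷ P? x xs with P? x
... | yes _ = refl
... | no  _ = refl

length-filter-map : {A : Set a} {B : Set b} {P : Pred B ℓ} (P? : Decidable P) (f : A → B) →
                    ∀ xs → length (filter P? (map f xs)) ≡ length (filter (P? ∘ f) xs)
length-filter-map P? f []       = refl
length-filter-map P? f (x ∷ xs) with P? (f x)
... | yes _ = cong suc (length-filter-map P? f xs)
... | no  _ = length-filter-map P? f xs

length-filter-tabulate : {A : Set a} {P : Pred A ℓ} (P? : Decidable P) (f : Fin n → A) →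
                         length (filter P? (tabulate f)) ≡ ∑[ i < n ] indicator (P? (f i))
length-filter-tabulate {n = zero}  P? f = refl
length-filter-tabulate {n = suc n} P? f =
  trans (length-filter-∷ P? (f zero) (tabulate (f ∘ suc)))
        (cong (indicator (P? (f zero)) +_) (length-filter-tabulate P? (f ∘ suc)))

length-filter-cartesianProductWith :
  {A : Set a} {B : Set b} {C : Set c} {P : Pred C ℓ} (P? : Decidable P)
  (g : A → B → C) (f : Fin n → A) (ys : List B) →
  length (filter P? (cartesianProductWith g (tabulate f) ys)) ≡
  ∑[ i < n ] length (filter (P? ∘ g (f i)) ys)
length-filter-cartesianProductWith {n = zero}  P? g f ys = refl
length-filter-cartesianProductWith {n = suc n} P? g f ys = begin
  length (filter P? (map (g (f zero)) ys ++ rest))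
    ≡⟨ cong length (filter-++ P? (map (g (f zero)) ys) rest) ⟩
  length (filter P? (map (g (f zero)) ys) ++ filter P? rest)
    ≡⟨ length-++ (filter P? (map (g (f zero)) ys)) ⟩
  length (filter P? (map (g (f zero)) ys)) + length (filter P? rest)
    ≡⟨ cong₂ _+_ (length-filter-map P? (g (f zero)) ys)
                 (length-filter-cartesianProductWith P? g (f ∘ suc) ys) ⟩
  ∑[ i < suc n ] length (filter (P? ∘ g (f i)) ys) ∎
  where
  open ≡-Reasoning
  rest = cartesianProductWith g (tabulate (f ∘ suc)) ys

sum-zero : {t : Fin n → ℕ} → (∀ i → t i ≡ 0) → sum t ≡ 0
sum-zero {n} t≡0 = trans (sum-cong-≗ t≡0) (sum-replicate-zero n)

sum-mono-≤ : {s t : Fin n → ℕ} → (∀ i → s i ≤ t i) → sum s ≤ sum t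
sum-mono-≤ {zero}  s≤t = z≤n
sum-mono-≤ {suc n} s≤t = +-mono-≤ (s≤t zero) (sum-mono-≤ (s≤t ∘ suc))

-- Counting along duplicate-free lists in a setoid

module _ (S : Setoid a ℓ) where
  open Setoid S using (Carrier) renaming (_≈_ to _∼_; sym to ∼-sym)
  open Membership S using () renaming (_∈_ to _∈ₛ_)

  lookup-injective : {xs : List Carrier} → Unique S xs →
                     ∀ i j → lookup xs i ∼ lookup xs j → i ≡ j
  lookup-injective {x ∷ xs} _                     zero    zero    _  = refl
  lookup-injective {x ∷ xs} (x∉xs AllPairs.∷ _)   zero    (suc j) eq =
    contradiction eq (All.lookup x∉xs (∈-lookup j))
  lookup-injective {x ∷ xs} (x∉xs AllPairs.∷ _)   (suc i) zero    eq =
    contradiction (∼-sym eq) (All.lookup x∉xs (∈-lookup i))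
  lookup-injective {x ∷ xs} (_    AllPairs.∷ xs!) (suc i) (suc j) eq =
    cong suc (lookup-injective xs! i j eq)

  -- Pigeonhole: sending an index of `xs` to the index of an equivalent entry of `ys` is injective,
  -- since the entries of `xs` are pairwise inequivalent.
  unique-⊆⇒length-≤ : {xs ys : List Carrier} → Unique S xs →
                      (∀ {x} → x ∈ₛ xs → x ∈ₛ ys) → length xs ≤ length ys
  unique-⊆⇒length-≤ {xs} {ys} xs! xs⊆ys = injective⇒≤ {f = λ i → index (∈ys i)} λ {i} {j} eq →
    lookup-injective xs! i j (Membershipₚ.index-injective S (∈ys i) (∈ys j) eq)
    where
    ∈ys : ∀ i → lookup xs i ∈ₛ ys
    ∈ys i = xs⊆ys (Membershipₚ.∈-lookup S xs i)

  -- Used in both directions, this makes a count independent of the enumeration along which it is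
  -- taken.
  length-filter-≤ : {P : Pred Carrier b} (P? : Decidable P) → (∀ {x y} → x ∼ y → P x → P y) →
                    {xs ys : List Carrier} → Unique S xs → (∀ x → x ∈ₛ ys) →
                    length (filter P? xs) ≤ length (filter P? ys)
  length-filter-≤ P? resp {xs} xs! ∈ys =
    unique-⊆⇒length-≤ (Unique.filter⁺ S P? xs!) λ {x} x∈ →
      Membershipₚ.∈-filter⁺ S P? resp (∈ys x) (proj₂ (Membershipₚ.∈-filter⁻ S P? resp {xs = xs} x∈))

-- Order-preserving maps of finite ordinals

punchIn-mono-< : ∀ (i : Fin (suc n)) {j k} → j <ᶠ k → punchIn i j <ᶠ punchIn i k
punchIn-mono-< i {j} {k} j<k = ≰⇒> (<⇒≱ j<k ∘ punchIn-cancel-≤ i k j)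

punchIn-cancel-< : ∀ (i : Fin (suc n)) {j k} → punchIn i j <ᶠ punchIn i k → j <ᶠ k
punchIn-cancel-< i {j} {k} ij<ik = ≰⇒> (<⇒≱ ij<ik ∘ punchIn-mono-≤ i k j)

data PunchView (i : Fin (suc n)) : Fin (suc n) → Set where
  hole    : PunchView i i
  punched : ∀ j → PunchView i (punchIn i j)

punchView : ∀ (i j : Fin (suc n)) → PunchView i j
punchView i j with i ≟ᶠ j
... | yes refl = hole
... | no  i≢j  = subst (PunchView i) (punchIn-punchOut i≢j) (punched (punchOut i≢j))

punchIn-fromℕ-< : (k : Fin n) → punchIn (fromℕ n) k <ᶠ fromℕ n
punchIn-fromℕ-< {n} k = Fin.≤∧≢⇒< (≤fromℕ (punchIn (fromℕ n) k)) (punchInᵢ≢i (fromℕ n) k)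

mono-reflects-zero : {f : Fin (suc m) → Fin (suc n)} → f Preserves _<ᶠ_ ⟶ _<ᶠ_ →
                     ∀ i → f i ≡ zero → i ≡ zero
mono-reflects-zero f-mono zero    _      = refl
mono-reflects-zero {f = f} f-mono (suc i) fi≡0 =
  contradiction (subst (f zero <ᶠ_) fi≡0 (f-mono {zero} {suc i} z<s)) n≮0

mono-reflects-fromℕ : {f : Fin (suc m) → Fin (suc n)} → f Preserves _<ᶠ_ ⟶ _<ᶠ_ →
                      ∀ i → f i ≡ fromℕ n → i ≡ fromℕ m
mono-reflects-fromℕ {m} {f = f} f-mono i fi≡n with i ≟ᶠ fromℕ m
... | yes i≡m = i≡m
... | no  i≢m = contradiction (≤fromℕ (f (fromℕ m)))
  (<⇒≱ (subst (_<ᶠ f (fromℕ m)) fi≡n (f-mono (Fin.≤∧≢⇒< (≤fromℕ i) i≢m))))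

strict-mono⇒reflects : {f : Fin m → Fin n} → f Preserves _<ᶠ_ ⟶ _<ᶠ_ →
                       ∀ {i j} → f i <ᶠ f j → i <ᶠ j
strict-mono⇒reflects {f = f} f-mono {i} {j} fi<fj with Fin.<-cmp i j
... | tri< i<j _    _   = i<j
... | tri≈ _   refl _   = contradiction refl (<⇒≢ fi<fj)
... | tri> _   _    j<i = contradiction (f-mono j<i) (Fin.<-asym fi<fj)

-- The point y lands at the position x determined by the number of values of g below y.
insert-mono : (g : Fin m → Fin n) → g Preserves _<ᶠ_ ⟶ _<ᶠ_ → (y : Fin (suc n)) →
              ∃[ x ] ∃[ f ] f Preserves _<ᶠ_ {suc m} ⟶ _<ᶠ_ {suc n} × f x ≡ y ×
                (∀ k → f (punchIn x k) ≡ punchIn y (g k))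
insert-mono {zero}  g g-mono y = zero , (λ _ → y) , (λ { {zero} {zero} () }) , refl , λ ()
insert-mono {suc m} {n} g g-mono y with y <ᶠ? punchIn y (g zero)
... | yes y<g₀ = zero , f , f-mono , refl , λ _ → refl
  where
  f : Fin (suc (suc m)) → Fin (suc n)
  f zero    = y
  f (suc k) = punchIn y (g k)
  f-mono : f Preserves _<ᶠ_ ⟶ _<ᶠ_
  f-mono {zero}  {suc zero}    _   = y<g₀
  f-mono {zero}  {suc (suc j)} _   =
    <-trans y<g₀ (punchIn-mono-< y (g-mono {zero} {suc j} z<s))
  f-mono {suc i} {suc j} (s<s i<j) = punchIn-mono-< y (g-mono i<j)
... | no  y≮g₀
  with x , f , f-mono , fx≡y , f-punchIn ← insert-mono (g ∘ suc) (g-mono ∘ s<s) y =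
  suc x , f⁺ , f⁺-mono , fx≡y , λ { zero → refl ; (suc k) → f-punchIn k }
  where
  f⁺ : Fin (suc (suc m)) → Fin (suc n)
  f⁺ zero    = punchIn y (g zero)
  f⁺ (suc k) = f k
  -- A later value is either `y` itself, where the failed test gives `≤` and `punchIn y` misses `y`,
  -- or comes from a later value of `g`.
  f⁺₀< : ∀ k → f⁺ zero <ᶠ f k
  f⁺₀< k with punchView x k
  ... | hole      = subst (f⁺ zero <ᶠ_) (sym fx≡y)
                      (Fin.≤∧≢⇒< (≮⇒≥ y≮g₀) (punchInᵢ≢i y (g zero)))
  ... | punched j = subst (f⁺ zero <ᶠ_) (sym (f-punchIn j))
                      (punchIn-mono-< y (g-mono {zero} {suc j} z<s))
  f⁺-mono : f⁺ Preserves _<ᶠ_ ⟶ _<ᶠ_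
  f⁺-mono {zero}  {suc j} _         = f⁺₀< j
  f⁺-mono {suc i} {suc j} (s<s i<j) = f-mono i<j

-- Patterns

⟨$⟩ʳ-injective : (π : Permutation′ n) → ∀ {i j} → π ⟨$⟩ʳ i ≡ π ⟨$⟩ʳ j → i ≡ j
⟨$⟩ʳ-injective π eq = trans (sym (inverseˡ π)) (trans (cong (π ⟨$⟩ˡ_) eq) (inverseˡ π))

insert-self : ∀ i j (π : Permutation′ n) → insert i j π ⟨$⟩ʳ i ≡ j
insert-self i j π with i ≟ᶠ i
... | yes _   = refl
... | no  i≢i = contradiction refl i≢i

insert-congʳ : ∀ i j (σ τ : Permutation′ n) → σ ≈ τ → insert i j σ ≈ insert i j τ
insert-congʳ i j σ τ σ≈τ k with i ≟ᶠ k
... | yes _ = refl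
... | no  _ = cong (punchIn j) (σ≈τ _)

∖-insert : ∀ i j (π : Permutation′ n) → insert i j π ∖ j ≈ π
∖-insert i j π k = trans
  (remove-cong {p = insert i j π} {insert i j π}
    (trans (cong (insert i j π ⟨$⟩ˡ_) (sym (insert-self i j π))) (inverseˡ (insert i j π)))
    (λ _ → refl) k)
  (remove-insert i j π k)

-- An occurrence seen on values instead of positions. This map plays for the largest and smallest
-- entries the part that `f` plays for the last and first ones.
≼-values : (p : Permutation′ m) (π : Permutation′ n) ((f , _) : p ≼ π) →
           (λ w → π ⟨$⟩ʳ f (p ⟨$⟩ˡ w)) Preserves _<ᶠ_ ⟶ _<ᶠ_
≼-values p π (f , _ , order) {v} {w} v<w =
  Equivalence.to (order (p ⟨$⟩ˡ v) (p ⟨$⟩ˡ w)) (subst₂ _<ᶠ_ (sym (inverseʳ p)) (sym (inverseʳ p)) v<w)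

≼-resp-≈ : (p : Permutation′ m) {π ρ : Permutation′ n} → π ≈ ρ → p ≼ π → p ≼ ρ
≼-resp-≈ p π≈ρ (f , f-mono , order) =
  f , f-mono , λ i j → subst₂ (λ v w → ((p ⟨$⟩ʳ i) <ᶠ (p ⟨$⟩ʳ j)) ⇔ (v <ᶠ w))
    (π≈ρ (f i)) (π≈ρ (f j)) (order i j)

-- Only `x` can be sent to `y`, so the other indices of `p` avoid `y` and `f` restricts to them,
-- whether or not the occurrence uses `y`.
remove-≼ : (p : Permutation′ (suc m)) (π : Permutation′ (suc n)) ((f , _) : p ≼ π) →
           ∀ {x y} → (∀ i → f i ≡ y → i ≡ x) → remove x p ≼ remove y π
remove-≼ p π (f , f-mono , order) {x} {y} f≡y⇒≡x =
  g , g-mono , λ i j → mk⇔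
    (λ lt → punchIn-cancel-< (π ⟨$⟩ʳ y) (subst₂ _<ᶠ_ (π-g i) (π-g j)
      (Equivalence.to (order _ _) (subst₂ _<ᶠ_ (sym (punchIn-permute p x i))
        (sym (punchIn-permute p x j)) (punchIn-mono-< (p ⟨$⟩ʳ x) lt)))))
    (λ lt → punchIn-cancel-< (p ⟨$⟩ʳ x) (subst₂ _<ᶠ_ (punchIn-permute p x i)
      (punchIn-permute p x j) (Equivalence.from (order _ _)
        (subst₂ _<ᶠ_ (sym (π-g i)) (sym (π-g j)) (punchIn-mono-< (π ⟨$⟩ʳ y) lt)))))
  where
  y≢f : ∀ k → y ≢ f (punchIn x k)
  y≢f k y≡f = punchInᵢ≢i x k (f≡y⇒≡x _ (sym y≡f))
  g : Fin _ → Fin _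
  g k = punchOut (y≢f k)
  punchIn-g : ∀ k → punchIn y (g k) ≡ f (punchIn x k)
  punchIn-g k = punchIn-punchOut (y≢f k)
  g-mono : g Preserves _<ᶠ_ ⟶ _<ᶠ_
  g-mono {i} {j} i<j = punchIn-cancel-< y
    (subst₂ _<ᶠ_ (sym (punchIn-g i)) (sym (punchIn-g j)) (f-mono (punchIn-mono-< x i<j)))
  π-g : ∀ k → π ⟨$⟩ʳ f (punchIn x k) ≡ punchIn (π ⟨$⟩ʳ y) (remove y π ⟨$⟩ʳ g k)
  π-g k = trans (cong (π ⟨$⟩ʳ_) (sym (punchIn-g k))) (punchIn-permute π y (g k))

-- The occurrence is enlarged by the entry of `π` at `y`. `insert-mono` is applied twice: to the
-- position map, which yields `x`, and to the value map, which yields `w`.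
insert-≼ : (q : Permutation′ m) (π : Permutation′ (suc n)) (y : Fin (suc n)) → q ≼ remove y π →
           ∃[ x ] ∃[ w ] Σ (insert x w q ≼ π) λ (f , _) → f x ≡ y
insert-≼ q π y occ@(g , g-mono , _)
  with x , f , f-mono , fx≡y , f-punchIn ← insert-mono g g-mono y
     | w , h , h-mono , hw≡v , h-punchIn ← insert-mono (λ u → remove y π ⟨$⟩ʳ g (q ⟨$⟩ˡ u))
                                                    (≼-values q (remove y π) occ) (π ⟨$⟩ʳ y) =
  x , w , (f , f-mono , λ i j → mk⇔
    (λ lt → subst₂ _<ᶠ_ (h-insert i) (h-insert j) (h-mono lt))
    (λ lt → strict-mono⇒reflects h-mono (subst₂ _<ᶠ_ (sym (h-insert i)) (sym (h-insert j)) lt))) ,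
  fx≡y
  where
  open ≡-Reasoning
  p = insert x w q
  -- `h` is the value map of the enlarged occurrence. Once it carries the entries of `p` to those of
  -- `π` along `f`, order-isomorphism follows from `h` being strictly increasing.
  h-insert : ∀ i → h (p ⟨$⟩ʳ i) ≡ π ⟨$⟩ʳ f i
  h-insert i with punchView x i
  ... | hole      = begin
    h (p ⟨$⟩ʳ x)  ≡⟨ cong h (insert-self x w q) ⟩
    h w           ≡⟨ hw≡v ⟩
    π ⟨$⟩ʳ y      ≡⟨ cong (π ⟨$⟩ʳ_) fx≡y ⟨
    π ⟨$⟩ʳ f x    ∎
  ... | punched k = begin
    h (p ⟨$⟩ʳ punchIn x k)                        ≡⟨ cong h (insert-punchIn x w q k) ⟩
    h (punchIn w (q ⟨$⟩ʳ k))                      ≡⟨ h-punchIn (q ⟨$⟩ʳ k) ⟩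
    punchIn (π ⟨$⟩ʳ y) (remove y π ⟨$⟩ʳ g (q ⟨$⟩ˡ (q ⟨$⟩ʳ k)))
      ≡⟨ cong (λ l → punchIn (π ⟨$⟩ʳ y) (remove y π ⟨$⟩ʳ g l)) (inverseˡ q) ⟩
    punchIn (π ⟨$⟩ʳ y) (remove y π ⟨$⟩ʳ g k)      ≡⟨ punchIn-permute π y (g k) ⟨
    π ⟨$⟩ʳ punchIn y (g k)                        ≡⟨ cong (π ⟨$⟩ʳ_) (f-punchIn k) ⟨
    π ⟨$⟩ʳ f (punchIn x k)                        ∎

Avoids-resp-≈ : (B : Collection ℓ) (π ρ : Permutation′ n) → π ≈ ρ → Avoids B π → Avoids B ρ
Avoids-resp-≈ B π ρ π≈ρ avoids p p∈B p≼ρ =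
  avoids p p∈B (≼-resp-≈ p {ρ} {π} (λ i → sym (π≈ρ i)) p≼ρ)

-- Inversions

module _ (π : Permutation′ n) where
  inversion? : ∀ i j → Dec (i <ᶠ j × (π ⟨$⟩ʳ j) <ᶠ (π ⟨$⟩ʳ i))
  inversion? i j = (i <ᶠ? j) ×-dec ((π ⟨$⟩ʳ j) <ᶠ? (π ⟨$⟩ʳ i))

  inversions-∑ : inversions π ≡ ∑[ i < n ] ∑[ j < n ] indicator (inversion? i j)
  inversions-∑ = trans
    (length-filter-cartesianProductWith (λ (i , j) → inversion? i j) _,_ (λ i → i) (allFin n))
    (sum-cong-≗ λ i → length-filter-tabulate (inversion? i) (λ j → j))

inversions-cong : (π ρ : Permutation′ n) → π ≈ ρ → inversions π ≡ inversions ρ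
inversions-cong π ρ π≈ρ = begin
  inversions π  ≡⟨ inversions-∑ π ⟩
  _             ≡⟨ (sum-cong-≗ λ i → sum-cong-≗ λ j → cong₂
                     (λ v w → indicator ((i <ᶠ? j) ×-dec (w <ᶠ? v))) (π≈ρ i) (π≈ρ j)) ⟩
  _             ≡⟨ inversions-∑ ρ ⟨
  inversions ρ  ∎
  where open ≡-Reasoning

module _ (y v : Fin (suc n)) (σ : Permutation′ n) where
  private
    π = insert y v σ
    E = λ i j → indicator (inversion? π i j)

  -- Whether the entry at position k of σ forms an inversion of π with the inserted entry, the
  -- latter being the larger, respectively the smaller, of the two.
  larger? : ∀ k → Dec (y <ᶠ punchIn y k × punchIn v (σ ⟨$⟩ʳ k) <ᶠ v)
  larger? k = (y <ᶠ? punchIn y k) ×-dec (punchIn v (σ ⟨$⟩ʳ k) <ᶠ? v)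

  smaller? : ∀ k → Dec (punchIn y k <ᶠ y × v <ᶠ punchIn v (σ ⟨$⟩ʳ k))
  smaller? k = (punchIn y k <ᶠ? y) ×-dec (v <ᶠ? punchIn v (σ ⟨$⟩ʳ k))

  inversions-as-larger inversions-as-smaller : ℕ
  inversions-as-larger  = ∑[ k < n ] indicator (larger? k)
  inversions-as-smaller = ∑[ k < n ] indicator (smaller? k)

  -- Row `y` and column `y` of the double sum hold the inversions of the inserted entry. The
  -- remaining block is that of `σ`, because `punchIn` preserves and reflects order in positions and
  -- in values.
  inversions-insert :
    inversions π ≡ (inversions-as-larger + inversions-as-smaller) + inversions σ
  inversions-insert = begin
    inversions π
      ≡⟨ inversions-∑ π ⟩
    ∑[ i < suc n ] ∑[ j < suc n ] E i j
      ≡⟨ sum-remove {i = y} (λ i → sum (E i)) ⟩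
    sum (E y) + ∑[ i < n ] sum (E (punchIn y i))
      ≡⟨ cong₂ _+_ (sum-remove {i = y} (E y))
                   (sum-cong-≗ λ i → sum-remove {i = y} (E (punchIn y i))) ⟩
    (E y y + ∑[ j < n ] E y (punchIn y j)) +
    ∑[ i < n ] (E (punchIn y i) y + ∑[ j < n ] E (punchIn y i) (punchIn y j))
      ≡⟨ cong₂ _+_ (cong₂ _+_ (indicator-false (inversion? π y y) (<-irrefl refl ∘ proj₁)) refl)
                   (∑-distrib-+ (λ i → E (punchIn y i) y) _) ⟩
    ∑[ j < n ] E y (punchIn y j) +
    (∑[ i < n ] E (punchIn y i) y + ∑[ i < n ] ∑[ j < n ] E (punchIn y i) (punchIn y j))
      ≡⟨ +-assoc (∑[ j < n ] E y (punchIn y j)) _ _ ⟨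
    (∑[ j < n ] E y (punchIn y j) + ∑[ i < n ] E (punchIn y i) y) +
    ∑[ i < n ] ∑[ j < n ] E (punchIn y i) (punchIn y j)
      ≡⟨ cong₂ _+_ (cong₂ _+_ (sum-cong-≗ larger) (sum-cong-≗ smaller))
                   (sum-cong-≗ λ i → sum-cong-≗ (other i)) ⟩
    (inversions-as-larger + inversions-as-smaller) +
    ∑[ i < n ] ∑[ j < n ] indicator (inversion? σ i j)
      ≡⟨ cong (inversions-as-larger + inversions-as-smaller +_) (inversions-∑ σ) ⟨
    (inversions-as-larger + inversions-as-smaller) + inversions σ ∎
    where
    open ≡-Reasoning
    larger : ∀ k → E y (punchIn y k) ≡ indicator (larger? k)
    larger k = cong₂ (λ a b → indicator ((y <ᶠ? punchIn y k) ×-dec (a <ᶠ? b)))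
      (insert-punchIn y v σ k) (insert-self y v σ)
    smaller : ∀ k → E (punchIn y k) y ≡ indicator (smaller? k)
    smaller k = cong₂ (λ a b → indicator ((punchIn y k <ᶠ? y) ×-dec (b <ᶠ? a)))
      (insert-punchIn y v σ k) (insert-self y v σ)
    other : ∀ i j → E (punchIn y i) (punchIn y j) ≡ indicator (inversion? σ i j)
    other i j = indicator-⇔ (mk⇔
      (λ (i<j , πj<πi) → punchIn-cancel-< y i<j , punchIn-cancel-< v
        (subst₂ _<ᶠ_ (insert-punchIn y v σ j) (insert-punchIn y v σ i) πj<πi))
      (λ (i<j , σj<σi) → punchIn-mono-< y i<j ,
        subst₂ _<ᶠ_ (sym (insert-punchIn y v σ j)) (sym (insert-punchIn y v σ i))
          (punchIn-mono-< v σj<σi)))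
      (inversion? π (punchIn y i) (punchIn y j)) (inversion? σ i j)

-- `punchIn v` runs once through all elements other than `v`, and exactly `toℕ v` of them are
-- smaller.
∑-punchIn-below : (v : Fin (suc n)) → ∑[ k < n ] indicator (punchIn v k <ᶠ? v) ≡ toℕ v
∑-punchIn-below {n}     zero    = sum-zero {n} λ k → indicator-false (suc k <ᶠ? zero {n}) λ ()
∑-punchIn-below {suc n} (suc v) = cong suc (trans
  (sum-cong-≗ λ k → indicator-⇔ (mk⇔ s<s⁻¹ s<s)
    (suc (punchIn v k) <ᶠ? suc v) (punchIn v k <ᶠ? v))
  (∑-punchIn-below v))

-- Of the elements other than `v`, the larger ones number `n` minus `toℕ v`, which is the numerical
-- value of `opposite v`.
∑-punchIn-above : (v : Fin (suc n)) → ∑[ k < n ] indicator (v <ᶠ? punchIn v k) ≡ toℕ (opposite v)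
∑-punchIn-above {n} zero = trans (all-above n) (sym (toℕ-fromℕ n))
  where
  all-above : ∀ n → ∑[ k < n ] indicator (zero {n} <ᶠ? suc k) ≡ n
  all-above zero    = refl
  all-above (suc n) = cong suc (all-above n)
∑-punchIn-above {suc n} (suc v) = trans
  (sum-cong-≗ λ k → indicator-⇔ (mk⇔ s<s⁻¹ s<s)
    (suc v <ᶠ? suc (punchIn v k)) (v <ᶠ? punchIn v k))
  (trans (∑-punchIn-above v) (sym (toℕ-inject₁ (opposite v))))

∑-punchIn-opposite : (v : Fin (suc n)) →
                     ∑[ k < n ] indicator (opposite v <ᶠ? punchIn (opposite v) k) ≡ toℕ v
∑-punchIn-opposite v = trans (∑-punchIn-above (opposite v)) (cong toℕ (opposite-involutive v))

-- For fixed e, a bijection between Fin (suc n) × S_n and S_(n+1), inverse to deleting the entry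
-- with value e π, whose first component counts the inversions lost by the deletion.
record InsertionScheme (e : ∀ {n} → Permutation′ (suc n) → Fin (suc n)) : Set where
  field
    position value : Fin (suc n) → Fin (suc n)

  ins : Fin (suc n) → Permutation′ n → Permutation′ (suc n)
  ins v = insert (position v) (value v)

  field
    e-ins          : ∀ (v : Fin (suc n)) σ → e (ins v σ) ≡ value v
    surjective     : ∀ (π : Permutation′ (suc n)) →
                     ∃[ v ] position v ≡ π ⟨$⟩ˡ e π × value v ≡ e π
    inversions-ins : ∀ (v : Fin (suc n)) σ → inversions (ins v σ) ≡ toℕ v + inversions σ
    ≼-reflects-e   : ∀ (p : Permutation′ (suc m)) (π : Permutation′ (suc n)) ((f , _) : p ≼ π) i →
                     π ⟨$⟩ʳ f i ≡ e π → p ⟨$⟩ʳ i ≡ e p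

-- The v inversions of the deleted entry are missing from those of σ.
avShifted : (B : Collection ℓ) (n k v : ℕ) → Decidable (Avoids B {n}) → ℕ
avShifted B n k v avoids? =
  length (filter (λ σ → (v + inversions σ ≟ k) ×-dec avoids? σ) (allPermutations n))

avShifted-≡-av : (B : Collection ℓ) (avoids? : Decidable (Avoids B {n})) → ∀ {k v} → v ≤ k →
                 avShifted B n k v avoids? ≡ av B n (k ∸ v) avoids?
avShifted-≡-av {n = n} B avoids? {k} {v} v≤k = cong length (filter-≐
  (λ σ → (v + inversions σ ≟ k) ×-dec avoids? σ)
  (λ σ → (inversions σ ≟ k ∸ v) ×-dec avoids? σ)
  ( (λ {σ} (eq , avoids) →
      +-cancelˡ-≡ v (inversions σ) _ (trans eq (sym (m+[n∸m]≡n v≤k))) , avoids)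
  , (λ (eq , avoids) → trans (cong (v +_) eq) (m+[n∸m]≡n v≤k) , avoids))
  (allPermutations n))

-- A counted `σ` would give `v ≤ v + inversions σ ≡ k`. Here `k ∸ v` truncates to 0, so
-- `av B n (k ∸ v)` could count the identity; stating the condition as a sum prevents this.
avShifted-≡-0 : (B : Collection ℓ) (avoids? : Decidable (Avoids B {n})) → ∀ {k v} → ¬ v ≤ k →
                avShifted B n k v avoids? ≡ 0
avShifted-≡-0 {n = n} B avoids? {k} {v} v≰k = cong length (filter-none
  (λ σ → (v + inversions σ ≟ k) ×-dec avoids? σ)
  (All.universal (λ σ (eq , _) → v≰k (subst (v ≤_) eq (m≤m+n v (inversions σ)))) (allPermutations n)))

avShifted-monotone : (B : Collection ℓ) → InversionMonotone B → ∀ n k v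
                     (avoids?₀ : Decidable (Avoids B {n})) (avoids?₁ : Decidable (Avoids B {suc n})) →
                     avShifted B n k v avoids?₀ ≤ avShifted B (suc n) k v avoids?₁
avShifted-monotone B mono n k v avoids?₀ avoids?₁ with v ≤? k
... | yes v≤k = subst₂ _≤_ (sym (avShifted-≡-av B avoids?₀ v≤k)) (sym (avShifted-≡-av B avoids?₁ v≤k))
                  (mono n (k ∸ v) avoids?₀ avoids?₁)
... | no  v≰k = subst (_≤ avShifted B (suc n) k v avoids?₁) (sym (avShifted-≡-0 B avoids?₀ v≰k)) z≤n

-- From insertion schemes to inversion monotonicity

module _ (e : ∀ {n} → Permutation′ (suc n) → Fin (suc n))
         (e-cong : ∀ {n} {p q : Permutation′ (suc n)} → p ≈ q → e p ≡ e q)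
         (scheme : InsertionScheme e) where
  open InsertionScheme scheme

  ins-∖ : (v : Fin (suc n)) (σ : Permutation′ n) → ins v σ ∖ e (ins v σ) ≈ σ
  ins-∖ v σ k = trans
    (∖-cong {p = ins v σ} {ins v σ} (e-ins v σ) (λ _ → refl) k)
    (∖-insert (position v) (value v) σ k)

  -- Deleting the distinguished entry recovers `σ`; then `v` is recovered as the difference between
  -- the inversion counts.
  ins-injective : (v w : Fin (suc n)) (σ τ : Permutation′ n) →
                  ins v σ ≈ ins w τ → v ≡ w × σ ≈ τ
  ins-injective v w σ τ eq = v≡w , σ≈τ
    where
    σ≈τ : σ ≈ τ
    σ≈τ k = trans (sym (ins-∖ v σ k)) (trans
      (∖-cong {p = ins v σ} {ins w τ} (e-cong {p = ins v σ} {ins w τ} eq) eq k)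
      (ins-∖ w τ k))
    open ≡-Reasoning
    v≡w : v ≡ w
    v≡w = toℕ-injective (+-cancelʳ-≡ (inversions σ) _ _ (begin
      toℕ v + inversions σ  ≡⟨ inversions-ins v σ ⟨
      inversions (ins v σ)  ≡⟨ inversions-cong (ins v σ) (ins w τ) eq ⟩
      inversions (ins w τ)  ≡⟨ inversions-ins w τ ⟩
      toℕ w + inversions τ  ≡⟨ cong (toℕ w +_) (inversions-cong σ τ σ≈τ) ⟨
      toℕ w + inversions σ  ∎))

  -- A second enumeration of the permutations of length `suc n`, organised by the distinguished
  -- entry instead of the first one.
  insertions : ∀ n → List (Permutation′ (suc n))
  insertions n = cartesianProductWith ins (allFin (suc n)) (allPermutations n)

  insertions-complete : (π : Permutation′ (suc n)) → Any (π ≈_) (insertions n)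
  insertions-complete π with v , position≡ , value≡ ← surjective π =
    Any.cartesianProductWith⁺ ins
      (λ { {_} {ρ} refl π∖e≈ρ i → trans (sym (ins-v i))
        (insert-congʳ (position v) (value v) (π ∖ e π) ρ π∖e≈ρ i) })
      (∈-allFin v) (allPermutations-complete (π ∖ e π))
    where
    ins-v : ins v (π ∖ e π) ≈ π
    -- `insert-remove` restores the value of `π` at the deleted position, which `inverseʳ`
    -- identifies with `e π`.
    ins-v i rewrite position≡ | value≡ = trans
      (cong (λ w → insert (π ⟨$⟩ˡ e π) w (π ∖ e π) ⟨$⟩ʳ i) (sym (inverseʳ π)))
      (insert-remove (π ⟨$⟩ˡ e π) π i)

  insertions-unique : ∀ n → Unique (permutationSetoid (suc n)) (insertions n)
  insertions-unique n = Unique.cartesianProductWith⁺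
    (setoid (Fin (suc n))) (permutationSetoid n) (permutationSetoid (suc n)) ins
    (λ {v} {w} {σ} {τ} → ins-injective v w σ τ)
    (allFin⁺ (suc n)) (allPermutations-unique n)

  module _ (B : Collection ℓ) where
    private
      Bᵉ : Collection ℓ
      Bᵉ = extend e (λ {n} {p} {q} → e-cong {n} {p} {q}) B

    -- An occurrence of `q` in `π ∖ e π`, enlarged by the deleted entry, is an occurrence in `π` of
    -- some `p`. By `≼-reflects-e` the added entry is the distinguished one of `p`, so `p ∖ e p ≈ q`
    -- and `p` lies in `Bᵉ`.
    Avoids-∖⁺ : (π : Permutation′ (suc n)) → Avoids Bᵉ π → Avoids B (π ∖ e π)
    Avoids-∖⁺ π avoids q q∈B q≼π∖e
      with x , w , occ@(f , _) , fx≡y ← insert-≼ q π (π ⟨$⟩ˡ e π) q≼π∖e =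
      avoids p (Collection.resp B {p = q} {p ∖ e p} q≈p∖e q∈B) occ
      where
      p = insert x w q
      w≡e : w ≡ e p
      w≡e = trans (sym (insert-self x w q))
        (≼-reflects-e p π occ x (trans (cong (π ⟨$⟩ʳ_) fx≡y) (inverseʳ π)))
      q≈p∖e : q ≈ p ∖ e p
      q≈p∖e k = trans (sym (∖-insert x w q k)) (∖-cong {p = p} {p} w≡e (λ _ → refl) k)

    -- By `≼-reflects-e`, an occurrence of `p` can use the distinguished entry of `π` only for that
    -- of `p`, so it survives both deletions. Members of `Bᵉ` have positive length, whence the
    -- single clause.
    Avoids-∖⁻ : (π : Permutation′ (suc n)) → Avoids B (π ∖ e π) → Avoids Bᵉ π
    Avoids-∖⁻ π avoids {suc m} p p∖e∈B occ = avoids (p ∖ e p) p∖e∈B (remove-≼ p π occ λ i fi≡y →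
      trans (sym (inverseˡ p)) (cong (p ⟨$⟩ˡ_)
        (≼-reflects-e p π occ i (trans (cong (π ⟨$⟩ʳ_) fi≡y) (inverseʳ π)))))

    Avoids-ins⁺ : (v : Fin (suc n)) (σ : Permutation′ n) → Avoids Bᵉ (ins v σ) → Avoids B σ
    Avoids-ins⁺ v σ = Avoids-resp-≈ B (ins v σ ∖ e (ins v σ)) σ (ins-∖ v σ) ∘ Avoids-∖⁺ (ins v σ)

    Avoids-ins⁻ : (v : Fin (suc n)) (σ : Permutation′ n) → Avoids B σ → Avoids Bᵉ (ins v σ)
    Avoids-ins⁻ v σ = Avoids-∖⁻ (ins v σ) ∘
      Avoids-resp-≈ B σ (ins v σ ∖ e (ins v σ)) (λ k → sym (ins-∖ v σ k))

    -- Both `allPermutations` and `insertions` list every permutation once up to `≈`, so the count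
    -- may be taken along `insertions`, where it splits according to `v`.
    av-extend : ∀ n k (avoidsᵉ? : Decidable (Avoids Bᵉ {suc n})) (avoids? : Decidable (Avoids B {n})) →
                av Bᵉ (suc n) k avoidsᵉ? ≡ ∑[ v < suc n ] avShifted B n k (toℕ v) avoids?
    av-extend n k avoidsᵉ? avoids? = begin
      av Bᵉ (suc n) k avoidsᵉ?
        ≡⟨ ≤-antisym
             (length-filter-≤ S P? (λ {π} {ρ} → P-resp π ρ)
               (allPermutations-unique (suc n)) insertions-complete)
             (length-filter-≤ S P? (λ {π} {ρ} → P-resp π ρ)
               (insertions-unique n) allPermutations-complete) ⟩
      length (filter P? (insertions n))
        ≡⟨ length-filter-cartesianProductWith P? ins (λ v → v) (allPermutations n) ⟩
      ∑[ v < suc n ] length (filter (P? ∘ ins v) (allPermutations n))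
        ≡⟨ (sum-cong-≗ λ v → cong length (filter-≐ (P? ∘ ins v)
             (λ σ → (toℕ v + inversions σ ≟ k) ×-dec avoids? σ)
             ( (λ {σ} (eq , avoids) → trans (sym (inversions-ins v σ)) eq , Avoids-ins⁺ v σ avoids)
             , (λ {σ} (eq , avoids) → trans (inversions-ins v σ) eq , Avoids-ins⁻ v σ avoids))
             (allPermutations n))) ⟩
      ∑[ v < suc n ] avShifted B n k (toℕ v) avoids? ∎
      where
      open ≡-Reasoning
      S = permutationSetoid (suc n)
      P? : Decidable (λ π → inversions π ≡ k × Avoids Bᵉ π)
      P? π = (inversions π ≟ k) ×-dec avoidsᵉ? π
      P-resp : ∀ π ρ → π ≈ ρ → inversions π ≡ k × Avoids Bᵉ π → inversions ρ ≡ k × Avoids Bᵉ ρ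
      P-resp π ρ π≈ρ (eq , avoids) =
        trans (sym (inversions-cong π ρ π≈ρ)) eq , Avoids-resp-≈ Bᵉ π ρ π≈ρ avoids

    Avoids-empty : (C : Collection ℓ) (π : Permutation′ 0) → Avoids C π
    Avoids-empty C π {zero}  p p∈C = contradiction (Collection.nonempty C {p = p} p∈C) n≮0
    Avoids-empty C π {suc m} p _ (f , _) = contradiction (f zero) λ ()

    extend-monotone : InversionMonotone B → InversionMonotone Bᵉ
    -- `av-extend` starts at length 1. At length 0 avoidance is automatic, so both counts equal the
    -- single summand `v = 0` for length 1.
    extend-monotone mono zero k avoidsᵉ?₀ avoidsᵉ?₁ = begin
      av Bᵉ 0 k avoidsᵉ?₀
        ≡⟨ cong length (filter-≐
             (λ π → (inversions π ≟ k) ×-dec avoidsᵉ?₀ π) (λ π → (inversions π ≟ k) ×-dec avoids? π)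
             ( (λ {π} (eq , _) → eq , Avoids-empty B π)
             , (λ {π} (eq , _) → eq , Avoids-empty Bᵉ π))
             (allPermutations 0)) ⟩
      avShifted B 0 k 0 avoids?
        ≡⟨ +-identityʳ _ ⟨
      ∑[ v < 1 ] avShifted B 0 k (toℕ v) avoids?
        ≡⟨ av-extend 0 k avoidsᵉ?₁ avoids? ⟨
      av Bᵉ 1 k avoidsᵉ?₁ ∎
      where
      open ≤-Reasoning
      avoids? : Decidable (Avoids B {0})
      avoids? π = yes (Avoids-empty B π)
    extend-monotone mono (suc n) k avoidsᵉ?₀ avoidsᵉ?₁ = begin
      av Bᵉ (suc n) k avoidsᵉ?₀
        ≡⟨ av-extend n k avoidsᵉ?₀ avoids?₀ ⟩
      ∑[ v < suc n ] avShifted B n k (toℕ v) avoids?₀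
        ≤⟨ sum-mono-≤ {suc n} (λ v → avShifted-monotone B mono n k (toℕ v) avoids?₀ avoids?₁) ⟩
      ∑[ v < suc n ] shifted (toℕ v)
        ≡⟨ (sum-cong-≗ {suc n} λ v → cong shifted (toℕ-inject₁ v)) ⟨
      ∑[ v < suc n ] shifted (toℕ (inject₁ v))
        -- The longer permutations contribute one further summand, for `v` equal to `suc n`;
        -- `inject₁` embeds the earlier indices.
        ≤⟨ m≤m+n _ _ ⟩
      ∑[ v < suc n ] shifted (toℕ (inject₁ v)) + shifted (toℕ (fromℕ (suc n)))
        ≡⟨ sum-init-last {suc n} (λ v → shifted (toℕ v)) ⟨
      ∑[ v < suc (suc n) ] shifted (toℕ v)
        ≡⟨ av-extend (suc n) k avoidsᵉ?₁ avoids?₁ ⟨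
      av Bᵉ (suc (suc n)) k avoidsᵉ?₁ ∎
      where
      open ≤-Reasoning
      -- Decisions are given for `Bᵉ` but the hypothesis asks for them for `B`. Testing `ins zero σ`
      -- supplies one; any other `v` would serve as well.
      avoids? : ∀ {n} → Decidable (Avoids Bᵉ {suc n}) → Decidable (Avoids B {n})
      avoids? avoidsᵉ? σ = map′ (Avoids-ins⁺ zero σ) (Avoids-ins⁻ zero σ) (avoidsᵉ? (ins zero σ))
      avoids?₀ = avoids? avoidsᵉ?₀
      avoids?₁ = avoids? avoidsᵉ?₁
      shifted : ℕ → ℕ
      shifted v = avShifted B (suc n) k v avoids?₁

-- The four insertion schemes

-- The first entry can only be the larger one in an inversion, so it takes part in as many as there
-- are values below it.
first-scheme : InsertionScheme (λ p → p ⟨$⟩ʳ zero)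
first-scheme = record
  { position       = λ _ → zero
  ; value          = λ v → v
  ; e-ins          = λ _ _ → refl
  ; surjective     = λ π → π ⟨$⟩ʳ zero , sym (inverseˡ π) , refl
  ; inversions-ins = λ v σ → trans (inversions-insert zero v σ)
      (cong (_+ inversions σ) (contribution v σ))
  ; ≼-reflects-e   = λ p π (f , f-mono , _) i eq →
      cong (p ⟨$⟩ʳ_) (mono-reflects-zero f-mono i (⟨$⟩ʳ-injective π eq))
  }
  where
  open ≡-Reasoning
  contribution : (v : Fin (suc n)) (σ : Permutation′ n) →
                 inversions-as-larger zero v σ + inversions-as-smaller zero v σ ≡ toℕ v
  contribution {n} v σ = begin
    inversions-as-larger zero v σ + inversions-as-smaller zero v σ
      ≡⟨ cong (inversions-as-larger zero v σ +_) (sum-zero {n} λ _ → refl) ⟩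
    inversions-as-larger zero v σ + 0
      ≡⟨ +-identityʳ _ ⟩
    ∑[ k < n ] indicator (punchIn v (σ ⟨$⟩ʳ k) <ᶠ? v)
      -- Reindexing along `σ` turns the sum over positions into a sum over values.
      ≡⟨ sum-permute (λ k → indicator (punchIn v k <ᶠ? v)) σ ⟨
    ∑[ k < n ] indicator (punchIn v k <ᶠ? v)
      ≡⟨ ∑-punchIn-below v ⟩
    toℕ v ∎

-- The last entry is inverted with exactly the larger values, so value `opposite v` is the one that
-- yields `v` inversions.
last-scheme : InsertionScheme (λ {n} p → p ⟨$⟩ʳ fromℕ n)
last-scheme = record
  { position       = λ {n} _ → fromℕ n
  ; value          = opposite
  ; e-ins          = λ {n} v σ → insert-self (fromℕ n) (opposite v) σ
  ; surjective     = λ {n} π → opposite (π ⟨$⟩ʳ fromℕ n) , sym (inverseˡ π) ,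
      opposite-involutive (π ⟨$⟩ʳ fromℕ n)
  ; inversions-ins = λ {n} v σ → trans (inversions-insert (fromℕ n) (opposite v) σ)
      (cong (_+ inversions σ) (contribution v σ))
  ; ≼-reflects-e   = λ p π (f , f-mono , _) i eq →
      cong (p ⟨$⟩ʳ_) (mono-reflects-fromℕ f-mono i (⟨$⟩ʳ-injective π eq))
  }
  where
  open ≡-Reasoning
  contribution : (v : Fin (suc n)) (σ : Permutation′ n) →
                 inversions-as-larger (fromℕ n) (opposite v) σ +
                 inversions-as-smaller (fromℕ n) (opposite v) σ ≡ toℕ v
  contribution {n} v σ = begin
    inversions-as-larger (fromℕ n) (opposite v) σ + inversions-as-smaller (fromℕ n) (opposite v) σ
      ≡⟨ cong (_+ inversions-as-smaller (fromℕ n) (opposite v) σ) (sum-zero {n} λ k →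
           indicator-false (larger? (fromℕ n) (opposite v) σ k)
             (≤⇒≯ (≤fromℕ (punchIn (fromℕ n) k)) ∘ proj₁)) ⟩
    inversions-as-smaller (fromℕ n) (opposite v) σ
      ≡⟨ (sum-cong-≗ {n} λ k → indicator-⇔ (mk⇔ proj₂ (punchIn-fromℕ-< k ,_))
           (smaller? (fromℕ n) (opposite v) σ k) (opposite v <ᶠ? punchIn (opposite v) (σ ⟨$⟩ʳ k))) ⟩
    ∑[ k < n ] indicator (opposite v <ᶠ? punchIn (opposite v) (σ ⟨$⟩ʳ k))
      ≡⟨ sum-permute (λ k → indicator (opposite v <ᶠ? punchIn (opposite v) k)) σ ⟨
    ∑[ k < n ] indicator (opposite v <ᶠ? punchIn (opposite v) k)
      ≡⟨ ∑-punchIn-opposite v ⟩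
    toℕ v ∎

-- The largest entry is inverted with everything to its right, so position `opposite v` yields `v`
-- inversions. An occurrence is increasing on values, so only the top value of `p` can reach the top
-- value of `π`.
largest-scheme : InsertionScheme (λ {n} _ → fromℕ n)
largest-scheme = record
  { position       = opposite
  ; value          = λ {n} _ → fromℕ n
  ; e-ins          = λ _ _ → refl
  ; surjective     = λ {n} π → opposite (π ⟨$⟩ˡ fromℕ n) , opposite-involutive (π ⟨$⟩ˡ fromℕ n) , refl
  ; inversions-ins = λ {n} v σ → trans (inversions-insert (opposite v) (fromℕ n) σ)
      (cong (_+ inversions σ) (contribution v σ))
  ; ≼-reflects-e   = λ p π occ@(f , _) i eq → mono-reflects-fromℕ (≼-values p π occ) (p ⟨$⟩ʳ i)
      (trans (cong (λ j → π ⟨$⟩ʳ f j) (inverseˡ p)) eq)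
  }
  where
  open ≡-Reasoning
  contribution : (v : Fin (suc n)) (σ : Permutation′ n) →
                 inversions-as-larger (opposite v) (fromℕ n) σ +
                 inversions-as-smaller (opposite v) (fromℕ n) σ ≡ toℕ v
  contribution {n} v σ = begin
    inversions-as-larger (opposite v) (fromℕ n) σ + inversions-as-smaller (opposite v) (fromℕ n) σ
      ≡⟨ cong (inversions-as-larger (opposite v) (fromℕ n) σ +_) (sum-zero {n} λ k →
           indicator-false (smaller? (opposite v) (fromℕ n) σ k)
             (≤⇒≯ (≤fromℕ (punchIn (fromℕ n) (σ ⟨$⟩ʳ k))) ∘ proj₂)) ⟩
    inversions-as-larger (opposite v) (fromℕ n) σ + 0
      ≡⟨ +-identityʳ _ ⟩
    inversions-as-larger (opposite v) (fromℕ n) σ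
      ≡⟨ (sum-cong-≗ {n} λ k → indicator-⇔ (mk⇔ proj₁ (_, punchIn-fromℕ-< (σ ⟨$⟩ʳ k)))
           (larger? (opposite v) (fromℕ n) σ k) (opposite v <ᶠ? punchIn (opposite v) k)) ⟩
    ∑[ k < n ] indicator (opposite v <ᶠ? punchIn (opposite v) k)
      ≡⟨ ∑-punchIn-opposite v ⟩
    toℕ v ∎

-- The smallest entry is inverted with everything to its left, so its position is already the number
-- of its inversions.
smallest-scheme : InsertionScheme (λ _ → zero)
smallest-scheme = record
  { position       = λ v → v
  ; value          = λ _ → zero
  ; e-ins          = λ _ _ → refl
  ; surjective     = λ π → π ⟨$⟩ˡ zero , refl , refl
  ; inversions-ins = λ v σ → trans (inversions-insert v zero σ)
      (cong (_+ inversions σ) (contribution v σ))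
  ; ≼-reflects-e   = λ p π occ@(f , _) i eq → mono-reflects-zero (≼-values p π occ) (p ⟨$⟩ʳ i)
      (trans (cong (λ j → π ⟨$⟩ʳ f j) (inverseˡ p)) eq)
  }
  where
  open ≡-Reasoning
  contribution : (v : Fin (suc n)) (σ : Permutation′ n) →
                 inversions-as-larger v zero σ + inversions-as-smaller v zero σ ≡ toℕ v
  contribution {n} v σ = begin
    inversions-as-larger v zero σ + inversions-as-smaller v zero σ
      ≡⟨ cong (_+ inversions-as-smaller v zero σ) (sum-zero {n} λ k →
           indicator-false (larger? v zero σ k) (n≮0 ∘ proj₂)) ⟩
    inversions-as-smaller v zero σ
      ≡⟨ (sum-cong-≗ {n} λ k → indicator-⇔ (mk⇔ proj₁ (_, z<s))
           (smaller? v zero σ k) (punchIn v k <ᶠ? v)) ⟩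
    ∑[ k < n ] indicator (punchIn v k <ᶠ? v)
      ≡⟨ ∑-punchIn-below v ⟩
    toℕ v ∎

proposition4p1 : {ℓ : Level} (B : Collection ℓ) → InversionMonotone B →
    InversionMonotone (B ˡ) × InversionMonotone (B ʳ) ×
    InversionMonotone (B ᵘ) × InversionMonotone (B ᵈ)
proposition4p1 B mono =
    extend-monotone _ (λ p≈q → p≈q zero) first-scheme B mono
  , extend-monotone _ (λ {n} p≈q → p≈q (fromℕ n)) last-scheme B mono
  , extend-monotone _ (λ _ → refl) largest-scheme B mono
  , extend-monotone _ (λ _ → refl) smallest-scheme B mono
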